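{- Let $G$ be a finite triangle-free graph with $\gamma^{\infty}(G)=\gamma(G)$. Then $\gamma^{\infty}(G)=\theta(G)$.
   Context: All graphs are finite, simple and undirected. A dominating set of $G=(V,E)$ is a set $D\subseteq V$ such that every vertex of $V-D$ is adjacent to a vertex of $D$; $\gamma(G)$ is the minimum size of a dominating set. Eternal domination ("one guard moves"): a defender chooses a set $D_1\subseteq V$ and places one guard on each vertex of $D_1$. Then, for $i=1,2,\ldots$ in turn, an attacker (knowing the current position) chooses a vertex $r_i\in V-D_i$, and the defender responds by moving exactly one guard to $r_i$ from an adjacent vertex $v\in D_i$, so that $D_{i+1}=(D_i-\{v\})\cup\{r_i\}$. Every $D_i$ must be a dominating set. $D_1$ is an eternal dominating set (EDS) if the defender, starting from $D_1$, can respond in this way forever to every infinite sequence of attacks. The eternal domination number $\gamma^{\infty}(G)$ is the minimum size of an EDS of $G$. The clique covering number $\theta(G)$ is the minimum number $k$ of sets in a partition $V=V_1\cup\cdots\cup V_k$ such that each induced subgraph $G[V_i]$ is complete. -}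

module Defs where

open import Data.Fin using (Fin)
open import Data.Fin.Subset using (Subset; _∈_; _∉_; _∪_; _-_; ⁅_⁆; ∣_∣)
open import Data.List using (List; []; _∷_)
open import Data.Nat using (ℕ; _≤_)
open import Data.Product using (_×_; ∃-syntax)
open import Data.Unit using (⊤)
open import Function.Definitions using (StrictlySurjective)
open import Level using (0ℓ)
open import Relation.Binary using (Rel; Decidable; Irreflexive; Symmetric)
open import Relation.Binary.PropositionalEquality using (_≡_; _≢_)
open import Relation.Nullary using (¬_)

-- Decidability of adjacency is part of what "finite graph" means
-- constructively.
record Graph (n : ℕ) : Set₁ where
  infix 4 _~_ _~?_
  field
    _~_      : Rel (Fin n) 0ℓ
    _~?_     : Decidable _~_
    ~-sym    : Symmetric _~_
    ~-irrefl : Irreflexive _≡_ _~_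

IsMinimum : (ℕ → Set) → ℕ → Set
IsMinimum P k = P k × (∀ m → P m → k ≤ m)

module _ {n : ℕ} (G : Graph n) where
  open Graph G

  TriangleFree : Set
  TriangleFree = ∀ u v w → u ~ v → v ~ w → ¬ (u ~ w)

  Dominating : Subset n → Set
  Dominating D = ∀ v → v ∉ D → ∃[ u ] (u ∈ D × u ~ v)

  -- A play is recorded by the attacks made so far, most recent first.  On being
  -- attacked at r after the attacks h, the defender moves the guard standing on
  -- σ h r to r: the reply may use the past of the play but not its future.
  Strategy : Set
  Strategy = List (Fin n) → Fin n → Fin n

  position : Strategy → Subset n → List (Fin n) → Subset n
  position σ D₁ []      = D₁
  position σ D₁ (r ∷ h) = (position σ D₁ h - σ h r) ∪ ⁅ r ⁆

  LegalAttacks : Strategy → Subset n → List (Fin n) → Set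
  LegalAttacks σ D₁ []      = ⊤
  LegalAttacks σ D₁ (r ∷ h) = r ∉ position σ D₁ h × LegalAttacks σ D₁ h

  -- An infinite play is lost only if it goes wrong after finitely many attacks,
  -- so σ answers every infinite attack sequence iff it never goes wrong after
  -- any finite one.
  record Winning (σ : Strategy) (D₁ : Subset n) : Set where
    field
      dominating : ∀ h → LegalAttacks σ D₁ h → Dominating (position σ D₁ h)
      occupied   : ∀ r h → LegalAttacks σ D₁ (r ∷ h) →
                   σ h r ∈ position σ D₁ h
      adjacent   : ∀ r h → LegalAttacks σ D₁ (r ∷ h) → σ h r ~ r

  EternalDominating : Subset n → Set
  EternalDominating D₁ = ∃[ σ ] Winning σ D₁

  -- The partition V = V₁ ∪ ⋯ ∪ Vₖ is given by the map sending a vertex to the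
  -- index of its part; surjectivity says that no part is empty.
  record CliquePartition (k : ℕ) : Set where
    field
      part     : Fin n → Fin k
      nonempty : StrictlySurjective _≡_ part
      complete : ∀ u v → part u ≡ part v → u ≢ v → u ~ v

  -- The graph parameters are given as relations: "IsX k" reads "X(G) = k".
  IsDominationNumber : ℕ → Set
  IsDominationNumber = IsMinimum λ k → ∃[ D ] (Dominating D × ∣ D ∣ ≡ k)

  IsEternalDominationNumber : ℕ → Set
  IsEternalDominationNumber =
    IsMinimum λ k → ∃[ D ] (EternalDominating D × ∣ D ∣ ≡ k)

  IsCliqueCoveringNumber : ℕ → Set
  IsCliqueCoveringNumber = IsMinimum CliquePartition

{-# OPTIONS --safe #-}

-- Let g be the guard that answers an attack at x.  If g has a private neighbour
-- p outside D, then p = x: after the move, only the guard on x can dominate p,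
-- and g, x, p would form a triangle.  So as soon as every answering guard has a
-- private neighbour, the unoccupied vertices answered by a given guard number
-- at most one, and the cells {g, x} form a clique partition with |D| parts.
-- If an answering guard g has no private neighbour, then |D| = γ forces g to be
-- isolated in G[D]; the attacked vertex x has another neighbour in D, so playing
-- g → x strictly shrinks the set of vertices isolated in G[D].  Hence finitely
-- many attacks lead to a position of the first kind.
module Submission where

open import Defs
open import Data.Bool using (true; false)
open import Data.Fin using (Fin; zero; suc; _≟_)
open import Data.Fin.Properties using (any?; all?; injective⇒≤; suc-injective)
open import Data.Fin.Subset using (Subset; _∈_; _∉_; _⊂_; _∪_; _-_; ⁅_⁆; ∣_∣)
open import Data.Fin.Subset.Induction using (⊂-wellFounded; Acc; acc)
open import Data.Fin.Subset.Properties
open import Data.List using (List; []; _∷_)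
open import Data.Nat using (ℕ; suc; _≤_; s≤s)
open import Data.Nat.Properties as ℕ using (≤-trans; ≤-antisym; ≤-reflexive; ≤-refl; <⇒≱)
open import Data.Product using (_×_; _,_; proj₁; proj₂; ∃-syntax)
open import Data.Sum using (inj₁; inj₂)
open import Data.Unit using (tt)
open import Data.Vec using (_∷_; here; there; tabulate)
open import Data.Vec.Properties using ([]=⇒lookup; lookup⇒[]=; lookup∘tabulate)
open import Function using (_∘_)
open import Relation.Binary.PropositionalEquality using (_≡_; _≢_; refl; sym; trans; cong; subst)
open import Relation.Nullary using (¬_; Dec; yes; no; contradiction; does; ¬?; _×-dec_; _→-dec_)
open import Relation.Nullary.Decidable using (dec-true; decidable-stable)
open import Relation.Unary using (Pred; Decidable)

-- Finite subsets: removal, insertion, comprehension and enumeration.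

x∉p-x : ∀ {n} (p : Subset n) x → x ∉ p - x
x∉p-x (_ ∷ p) (suc x) (there x∈) = x∉p-x p x x∈

x∈p∧x∉p-y⇒x≡y : ∀ {n} {p : Subset n} {x y} → x ∈ p → x ∉ p - y → x ≡ y
x∈p∧x∉p-y⇒x≡y {x = x} {y} x∈p x∉ =
  decidable-stable (x ≟ y) λ x≢y → x∉ (x∈p∧x≢y⇒x∈p-y x∈p x≢y)

∣p∪⁅x⁆∣≤1+∣p∣ : ∀ {n} (p : Subset n) x → ∣ p ∪ ⁅ x ⁆ ∣ ≤ suc ∣ p ∣
∣p∪⁅x⁆∣≤1+∣p∣ (true  ∷ p) zero    rewrite ∪-identityʳ p = ℕ.n≤1+n _
∣p∪⁅x⁆∣≤1+∣p∣ (false ∷ p) zero    rewrite ∪-identityʳ p = ≤-refl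
∣p∪⁅x⁆∣≤1+∣p∣ (true  ∷ p) (suc x) = s≤s (∣p∪⁅x⁆∣≤1+∣p∣ p x)
∣p∪⁅x⁆∣≤1+∣p∣ (false ∷ p) (suc x) = ∣p∪⁅x⁆∣≤1+∣p∣ p x

module _ {n} {p} {P : Pred (Fin n) p} (P? : Decidable P) where

  comprehension : Subset n
  comprehension = tabulate (does ∘ P?)

  ∈-comprehension⁺ : ∀ {x} → P x → x ∈ comprehension
  ∈-comprehension⁺ {x} Px =
    lookup⇒[]= x _ (trans (lookup∘tabulate _ x) (dec-true (P? x) Px))

  ∈-comprehension⁻ : ∀ {x} → x ∈ comprehension → P x
  ∈-comprehension⁻ {x} x∈ with P? x | trans (sym (lookup∘tabulate (does ∘ P?) x)) ([]=⇒lookup x∈)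
  ... | yes Px | _ = Px

-- The increasing enumeration of `p`. With its inverse `index` it lets the guards of a position
-- number the parts of a clique partition.
element : ∀ {n} (p : Subset n) → Fin ∣ p ∣ → Fin n
element (true  ∷ p) zero    = zero
element (true  ∷ p) (suc i) = suc (element p i)
element (false ∷ p) i       = suc (element p i)

element-∈ : ∀ {n} (p : Subset n) i → element p i ∈ p
element-∈ (true  ∷ p) zero    = here
element-∈ (true  ∷ p) (suc i) = there (element-∈ p i)
element-∈ (false ∷ p) i       = there (element-∈ p i)

element-injective : ∀ {n} (p : Subset n) {i j} → element p i ≡ element p j → i ≡ j
element-injective (true  ∷ p) {zero}  {zero}  _  = refl
element-injective (true  ∷ p) {suc i} {suc j} eq = cong suc (element-injective p (suc-injective eq))
element-injective (false ∷ p) eq = element-injective p (suc-injective eq)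

index : ∀ {n} (p : Subset n) {x} → x ∈ p → Fin ∣ p ∣
index (true  ∷ p) here       = zero
index (true  ∷ p) (there x∈) = suc (index p x∈)
index (false ∷ p) (there x∈) = index p x∈

element-index : ∀ {n} (p : Subset n) {x} (x∈ : x ∈ p) → element p (index p x∈) ≡ x
element-index (true  ∷ p) here       = refl
element-index (true  ∷ p) (there x∈) = cong suc (element-index p x∈)
element-index (false ∷ p) (there x∈) = cong suc (element-index p x∈)

-- Clique partitions bound the domination number from above.

module _ {n : ℕ} (G : Graph n) where
  open Graph G

  -- One representative per part dominates, because parts are complete. This gives the inequality
  -- between γ and θ that holds in every graph.
  CliquePartition⇒Dominating : ∀ {m} → CliquePartition G m →
                               ∃[ D ] (Dominating G D × ∣ D ∣ ≤ m)
  CliquePartition⇒Dominating {m} C = D , dom , injective⇒≤ {f = part ∘ element D} inj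
    where
    open CliquePartition C

    -- The witness depends only on the index of the part, so `rep` is idempotent and its fixed
    -- points meet each part exactly once.
    rep : Fin n → Fin n
    rep v = proj₁ (nonempty (part v))

    part-rep : ∀ v → part (rep v) ≡ part v
    part-rep v = proj₂ (nonempty (part v))

    rep? : Decidable (λ v → rep v ≡ v)
    rep? v = rep v ≟ v

    D : Subset n
    D = comprehension rep?

    dom : Dominating G D
    dom v v∉D = rep v
      , ∈-comprehension⁺ rep? (cong (proj₁ ∘ nonempty) (part-rep v))
      , complete _ _ (part-rep v) (v∉D ∘ ∈-comprehension⁺ rep?)

    inj : ∀ {i j} → part (element D i) ≡ part (element D j) → i ≡ j
    inj {i} {j} eq = element-injective D (trans (sym (∈-comprehension⁻ rep? (element-∈ D i)))
      (trans (cong (proj₁ ∘ nonempty) eq) (∈-comprehension⁻ rep? (element-∈ D j))))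

  -- Private neighbours and isolated guards.

  OtherNeighbour : Subset n → Fin n → Fin n → Set
  OtherNeighbour D g p = ∃[ u ] (u ∈ D × u ~ p × u ≢ g)

  otherNeighbour? : ∀ D g p → Dec (OtherNeighbour D g p)
  otherNeighbour? D g p = any? λ u → (u ∈? D) ×-dec ((u ~? p) ×-dec ¬? (u ≟ g))

  PrivateNeighbour : Subset n → Fin n → Fin n → Set
  PrivateNeighbour D g p = p ∉ D × g ~ p × ¬ OtherNeighbour D g p

  privateNeighbour? : ∀ D g p → Dec (PrivateNeighbour D g p)
  privateNeighbour? D g p = ¬? (p ∈? D) ×-dec ((g ~? p) ×-dec ¬? (otherNeighbour? D g p))

  HasPrivateNeighbour : Subset n → Fin n → Set
  HasPrivateNeighbour D g = ∃[ p ] PrivateNeighbour D g p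

  hasPrivateNeighbour? : ∀ D g → Dec (HasPrivateNeighbour D g)
  hasPrivateNeighbour? D g = any? (privateNeighbour? D g)

  Isolated : Subset n → Fin n → Set
  Isolated D v = v ∈ D × (∀ u → u ∈ D → ¬ (u ~ v))

  isolated? : ∀ D → Decidable (Isolated D)
  isolated? D v = (v ∈? D) ×-dec all? λ u → (u ∈? D) →-dec ¬? (u ~? v)

  isolated : Subset n → Subset n
  isolated D = comprehension (isolated? D)

  otherNeighbour : ∀ {D g p} → ¬ HasPrivateNeighbour D g → p ∉ D → g ~ p → OtherNeighbour D g p
  otherNeighbour {D} {g} {p} ¬priv p∉D g~p =
    decidable-stable (otherNeighbour? D g p) λ ¬other → ¬priv (p , p∉D , g~p , ¬other)

  -- The vertex `g` itself is now dominated by `u`, and each vertex outside `D` that relied on `g`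
  -- has another neighbour in `D`.
  Dominating-remove : ∀ {D g u} → Dominating G D → ¬ HasPrivateNeighbour D g →
                      u ∈ D → u ~ g → Dominating G (D - g)
  Dominating-remove {D} {g} {u} dom ¬priv u∈D u~g v v∉ with v ∈? D
  ... | yes v∈D with refl ← x∈p∧x∉p-y⇒x≡y v∈D v∉ =
    u , x∈p∧x≢y⇒x∈p-y u∈D (λ u≡g → ~-irrefl u≡g u~g) , u~g
  ... | no v∉D with dom v v∉D
  ...   | w , w∈D , w~v with w ≟ g
  ...     | no w≢g = w , x∈p∧x≢y⇒x∈p-y w∈D w≢g , w~v
  ...     | yes refl with otherNeighbour ¬priv v∉D w~v
  ...       | t , t∈D , t~v , t≢g = t , x∈p∧x≢y⇒x∈p-y t∈D t≢g , t~v

  -- The effect of a single move.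

  move : Subset n → Fin n → Fin n → Subset n
  move D g r = (D - g) ∪ ⁅ r ⁆

  ∣move∣≤ : ∀ {D g} r → g ∈ D → ∣ move D g r ∣ ≤ ∣ D ∣
  ∣move∣≤ {D} {g} r g∈D = ≤-trans (∣p∪⁅x⁆∣≤1+∣p∣ (D - g) r) (x∈p⇒∣p-x∣<∣p∣ g∈D)

  ∈-move : ∀ {D g r x} → x ∈ D → x ≢ g → x ∈ move D g r
  ∈-move x∈D x≢g = p⊆p∪q _ (x∈p∧x≢y⇒x∈p-y x∈D x≢g)

  -- The move takes `g` out of the isolated set, and `r` does not enter it, since the guard on `w`
  -- stays in place next to `r`.
  isolated-shrinks : ∀ {D g r} → r ∉ D → Isolated D g → OtherNeighbour D g r →
                     isolated (move D g r) ⊂ isolated D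
  isolated-shrinks {D} {g} {r} r∉D g-iso@(g∈D , g-lonely) (w , w∈D , w~r , w≢g) =
    ∈-comprehension⁺ (isolated? D) ∘ shrink ∘ ∈-comprehension⁻ (isolated? (move D g r)) ,
    g , ∈-comprehension⁺ (isolated? D) g-iso ,
    g∉move ∘ proj₁ ∘ ∈-comprehension⁻ (isolated? (move D g r))
    where
    g∉move : g ∉ move D g r
    g∉move g∈ with x∈p∪q⁻ (D - g) ⁅ r ⁆ g∈
    ... | inj₁ g∈D-g = x∉p-x D g g∈D-g
    ... | inj₂ g∈⁅r⁆ = r∉D (subst (_∈ D) (x∈⁅y⁆⇒x≡y r g∈⁅r⁆) g∈D)

    shrink : ∀ {v} → Isolated (move D g r) v → Isolated D v
    shrink {v} (v∈ , lonely) with x∈p∪q⁻ (D - g) ⁅ r ⁆ v∈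
    ... | inj₂ v∈⁅r⁆ with refl ← x∈⁅y⁆⇒x≡y r v∈⁅r⁆ =
      contradiction w~r (lonely w (∈-move w∈D w≢g))
    ... | inj₁ v∈D-g = v∈D , lonely′
      where
      v∈D = p─q⊆p D ⁅ g ⁆ v∈D-g

      lonely′ : ∀ u → u ∈ D → ¬ (u ~ v)
      -- After the move `lonely` says nothing about the departed `g`; that case is covered by the
      -- isolation of `g` in `D`.
      lonely′ u u∈D with u ≟ g
      ... | yes refl = g-lonely v v∈D ∘ ~-sym
      ... | no u≢g   = lonely u (∈-move u∈D u≢g)

  privateNeighbour-attacked : TriangleFree G → ∀ {D g r p} → Dominating G (move D g r) →
                              g ~ r → PrivateNeighbour D g p → p ≡ r
  privateNeighbour-attacked tf {D} {g} {r} {p} dom g~r (p∉D , g~p , ¬other) with p ≟ r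
  ... | yes p≡r = p≡r
  ... | no p≢r with dom p p∉move
    where
    p∉move : p ∉ move D g r
    p∉move p∈ with x∈p∪q⁻ (D - g) ⁅ r ⁆ p∈
    ... | inj₁ p∈D-g = p∉D (p─q⊆p D ⁅ g ⁆ p∈D-g)
    ... | inj₂ p∈⁅r⁆ = p≢r (x∈⁅y⁆⇒x≡y r p∈⁅r⁆)
  ...   | u , u∈ , u~p with x∈p∪q⁻ (D - g) ⁅ r ⁆ u∈
  -- A dominator left over from `D` contradicts the privacy of `p`; the only other candidate, `r`,
  -- closes a triangle with `g` and `p`.
  ...     | inj₁ u∈D-g = contradiction
    (u , p─q⊆p D ⁅ g ⁆ u∈D-g , u~p , λ { refl → x∉p-x D u u∈D-g }) ¬other
  ...     | inj₂ u∈⁅r⁆ with refl ← x∈⁅y⁆⇒x≡y r u∈⁅r⁆ =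
    contradiction g~p (tf g r p g~r u~p)

  -- Playing against a winning strategy with a minimum number of guards.

  module _ {k : ℕ} (γ-min : ∀ {D} → Dominating G D → k ≤ ∣ D ∣)
           {σ : Strategy G} {D₁ : Subset n} (win : Winning G σ D₁) (∣D₁∣≤k : ∣ D₁ ∣ ≤ k) where
    open Winning win

    pos : List (Fin n) → Subset n
    pos = position G σ D₁

    Legal : List (Fin n) → Set
    Legal = LegalAttacks G σ D₁

    -- Moves never add guards. As every legal position dominates, `γ-min` supplies the reverse
    -- bound, so all of them are minimum dominating sets.
    ∣pos∣≤k : ∀ h → Legal h → ∣ pos h ∣ ≤ k
    ∣pos∣≤k []      _     = ∣D₁∣≤k
    ∣pos∣≤k (r ∷ h) legal =
      ≤-trans (∣move∣≤ r (occupied r h legal)) (∣pos∣≤k h (proj₂ legal))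

    -- A neighbour of `g` inside the position would make `g` redundant, leaving a dominating set
    -- with fewer than `k` vertices.
    ¬private⇒Isolated : ∀ {g} h → Legal h → g ∈ pos h → ¬ HasPrivateNeighbour (pos h) g →
                        Isolated (pos h) g
    ¬private⇒Isolated h legal g∈ ¬priv = g∈ , λ u u∈ u~g →
      <⇒≱ (x∈p⇒∣p-x∣<∣p∣ g∈) (≤-trans (∣pos∣≤k h legal)
        (γ-min (Dominating-remove (dominating h legal) ¬priv u∈ u~g)))

    RepliesPrivate : List (Fin n) → Set
    RepliesPrivate h = ∀ r → r ∉ pos h → HasPrivateNeighbour (pos h) (σ h r)

    reachRepliesPrivate : ∀ h → Legal h → Acc _⊂_ (isolated (pos h)) →
                          ∃[ h′ ] (Legal h′ × RepliesPrivate h′)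
    reachRepliesPrivate h legal (acc rec)
      -- Search for an attack answered by a guard without a private neighbour. If there is one, play
      -- it and recurse on the smaller isolated set.
      with any? (λ r → ¬? (r ∈? pos h) ×-dec ¬? (hasPrivateNeighbour? (pos h) (σ h r)))
    ... | no ¬bad = h , legal , λ r r∉ →
      decidable-stable (hasPrivateNeighbour? (pos h) (σ h r)) λ ¬priv → ¬bad (r , r∉ , ¬priv)
    ... | yes (r , r∉ , ¬priv) = reachRepliesPrivate (r ∷ h) legal′ (rec
      (isolated-shrinks r∉ (¬private⇒Isolated h legal (occupied r h legal′) ¬priv)
        (otherNeighbour ¬priv r∉ (adjacent r h legal′))))
      where
      legal′ : Legal (r ∷ h)
      legal′ = r∉ , legal

    RepliesPrivate⇒CliquePartition : TriangleFree G → ∀ h → Legal h → RepliesPrivate h →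
                                     CliquePartition G ∣ pos h ∣
    RepliesPrivate⇒CliquePartition tf h legal private-reply = record
      { part     = λ v → index D (guard-∈ v)
      -- Each guard lies in its own part, so no part is empty.
      ; nonempty = λ i → element D i , element-injective D
          (trans (element-index D _) (guard-fixes (element-∈ D i)))
      ; complete = λ u v eq → cell-complete u v
          (trans (sym (element-index D _)) (trans (cong (element D) eq) (element-index D _)))
      }
      where
      D = pos h

      guard : Fin n → Fin n
      guard v with v ∈? D
      ... | yes _ = v
      ... | no  _ = σ h v

      guard-∈ : ∀ v → guard v ∈ D
      guard-∈ v with v ∈? D
      ... | yes v∈ = v∈
      ... | no v∉  = occupied v h (v∉ , legal)

      guard-fixes : ∀ {v} → v ∈ D → guard v ≡ v
      guard-fixes {v} v∈ with v ∈? D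
      ... | yes _  = refl
      ... | no v∉  = contradiction v∈ v∉

      adj : ∀ {v} → v ∉ D → σ h v ~ v
      adj {v} v∉ = adjacent v h (v∉ , legal)

      attacked : ∀ {p v} → v ∉ D → PrivateNeighbour D (σ h v) p → p ≡ v
      attacked {v = v} v∉ =
        privateNeighbour-attacked tf (dominating (v ∷ h) (v∉ , legal)) (adj v∉)

      cell-complete : ∀ u v → guard u ≡ guard v → u ≢ v → u ~ v
      cell-complete u v eq u≢v with u ∈? D | v ∈? D
      ... | yes _ | yes _  = contradiction eq u≢v
      ... | yes _ | no v∉  = subst (_~ v) (sym eq) (adj v∉)
      ... | no u∉ | yes _  = ~-sym (subst (_~ u) eq (adj u∉))
      -- Two unoccupied vertices answered by the same guard both equal its private neighbour `p`,
      -- hence each other.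
      ... | no u∉ | no v∉ with private-reply u u∉
      ...   | p , priv = contradiction
        (trans (sym (attacked u∉ priv))
               (attacked v∉ (subst (λ g → PrivateNeighbour D g p) eq priv)))
        u≢v

    cliquePartition : TriangleFree G → CliquePartition G k
    cliquePartition tf with reachRepliesPrivate [] tt (⊂-wellFounded _)
    ... | h , legal , private-reply = subst (CliquePartition G)
      -- The number of parts is the size of the position reached, which is exactly `k`.
      (≤-antisym (∣pos∣≤k h legal) (γ-min (dominating h legal)))
      (RepliesPrivate⇒CliquePartition tf h legal private-reply)

theorem6p6 : ∀ (n : ℕ) (G : Graph n) → TriangleFree G →
    ∀ (k : ℕ) → IsEternalDominationNumber G k → IsDominationNumber G k →
    IsCliqueCoveringNumber G k
theorem6p6 n G tf k ((D₁ , (σ , win) , ∣D₁∣≡k) , _) (_ , γ-least) =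
  cliquePartition G γ-min win (≤-reflexive ∣D₁∣≡k) tf ,
  -- Minimality: a partition into `m` cliques yields a dominating set of at most `m` vertices, and
  -- `k` is the domination number.
  λ m C → let D , dom , ∣D∣≤m = CliquePartition⇒Dominating G C
          in ≤-trans (γ-min dom) ∣D∣≤m
  where
  γ-min : ∀ {D} → Dominating G D → k ≤ ∣ D ∣
  γ-min {D} dom = γ-least ∣ D ∣ (D , dom , refl)
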